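{- There is a universal constant $C>0$ such that the following holds. Let $(T,b)$ be a vtree over a set $X$ of $n\ge 1$ variables, and let $D$ be a TDD over $(T,b)$ of width $w(D)$. Then there exist a linear order $\leq$ on $X$ and an m-OBDD $B$ respecting $\leq$ that corresponds to $D$ and has size at most $$C\cdot\left(\sqrt{n}\cdot w(D)\right)^{\log_2(n)+2}.$$
   Context: **Vtree.** A variable tree (vtree) over a finite variable set $X$ is a pair $(T,b)$ where $T$ is a rooted full binary tree (every node has 0 or 2 children) and $b$ is a bijection from the leaves of $T$ to $X$. **TDD.** A Tree Decision Diagram over (respecting) the vtree $(T,b)$ is a tuple $D=((T,b),N,E,\mathrm{out},\lambda)$ where: - $N$ maps each $t\in V(T)$ to a finite nonempty set $N(t)$ (the nodes of $D$ at $t$), with $N(t_1)\cap N(t_2)=\emptyset$ for $t_1\neq t_2$. - For every non-leaf $t\in V(T)$ with children $t_1,t_2$ (in an arbitrary but fixed order), $E$ assigns to each $u\in N(t)$ a set $E(u)\subseteq N(t_1)\times N(t_2)$, and the sets $\{E(u)\mid u\in N(t)\}$ form a partition of $N(t_1)\times N(t_2)$ (for distinct $u$ they are nonempty and disjoint, and together they cover everything). - $\mathrm{out}$ is a set of output labels with $|\mathrm{out}|=|N(r)|$, where $r$ is the root of $T$, and $\lambda:\mathrm{out}\to N(r)$ is a bijection. Semantics: if $t$ is a leaf with $b(t)=x$, each $u\in N(t)$ carries a label $D[u]\in\{x,\neg x,0,1\}$; for distinct $u_1,u_2\in N(t)$ the functions $D[u_1],D[u_2]$ are not simultaneously satisfiable,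 and (completeness) each of the two values of $x$ satisfies some $D[u]$ with $u\in N(t)$. If $t$ is not a leaf and $u\in N(t)$, then $D[u]=\bigvee_{(v,w)\in E(u)}(D[v]\wedge D[w])$. For $\ell\in\mathrm{out}$ put $D[\ell]:=D[\lambda(\ell)]$; we also write $\mathrm{out}(D)$ for $\mathrm{out}$. The width of $D$ is $w(D)=\max_{t\in V(T)}|N(t)|$. **m-OBDD.** A multisink-OBDD (m-OBDD) $B$ respecting a linear order $\le$ on $X$ is defined as an OBDD in the usual sense (a directed acyclic graph with one source, whose inner nodes are labelled by variables of $X$ and have one outgoing 0-edge and one outgoing 1-edge, with variables tested along each path in strictly increasing order), except that instead of two sinks it may have several sinks, each labelled with a unique output. The set of labels is $\mathrm{out}(B)$. For $\ell\in\mathrm{out}(B)$, $B[\ell]$ is the Boolean function on $X$ whose satisfying assignments are those following a path from the source to the sink labelled $\ell$ (constant $0$ if that sink is unreachable). The size of $B$ is its number of nodes. **Corresponds.** $B$ corresponds to $D$ if there is a bijection $f:\mathrm{out}(B)\to\mathrm{out}(D)$ with $B[\ell]\equiv D[f(\ell)]$ for all $\ell\in\mathrm{out}(B)$. -}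

module Defs where

open import Data.Bool.Base using (Bool; false; true; not; T)
open import Data.Fin.Base using (Fin)
open import Data.Nat.Base using (ℕ; NonZero; _+_; _*_; _^_; _⊔_; _≤_; _<_)
open import Data.Product.Base using (∃; ∃₂; Σ-syntax; _×_; _,_)
open import Data.Sum.Base using (_⊎_; inj₁; inj₂)
open import Function.Base using (_∘_)
open import Function.Bundles using (_↔_; Inverse)
open import Level using (0ℓ)
open import Relation.Binary.Construct.Closure.ReflexiveTransitive using (Star)
open import Relation.Binary.Construct.Closure.Transitive using (TransClosure)
open import Relation.Binary.Core using (Rel)
open import Relation.Binary.PropositionalEquality.Core using (_≡_; _≢_)
open import Relation.Nullary.Negation.Core using (¬_)
open import Relation.Unary using (Pred; Satisfiable; Empty; _∩_; _∈_; _≐_)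
import Relation.Binary.Construct.NonStrictToStrict as ToStrict

-- A Boolean function is given by its set of satisfying assignments;
-- equality of Boolean functions is _≐_.

BooleanFunction : Set → Set₁
BooleanFunction X = Pred (X → Bool) 0ℓ

data Tree : Set where
  leaf : Tree
  node : (t₁ t₂ : Tree) → Tree

data Leaf : Tree → Set where
  here  : Leaf leaf
  left  : ∀ {t₁ t₂} → Leaf t₁ → Leaf (node t₁ t₂)
  right : ∀ {t₁ t₂} → Leaf t₂ → Leaf (node t₁ t₂)

record VTree (X : Set) : Set where
  field
    tree : Tree
    b    : Leaf tree ↔ X

-- The labels x, ¬x, 0 and 1, where x is the variable at the leaf.

data Label : Set where
  pos neg zero one : Label

evalLabel : Label → Bool → Bool
evalLabel pos  v = v
evalLabel neg  v = not v
evalLabel zero _ = false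
evalLabel one  _ = true

record IsPartition {I A : Set} (P : I → Pred A 0ℓ) : Set where
  field
    nonempty : ∀ i → Satisfiable (P i)
    disjoint : ∀ {i j} → i ≢ j → Empty (P i ∩ P j)
    covers   : ∀ a → ∃ λ i → a ∈ P i

-- Diagram t k collects the data N, E and the leaf labels for the subtree t,
-- where k = |N(root of t)|.  The nodes at a vertex are numbered by Fin, so
-- the node sets of different vertices are disjoint by typing.

data Diagram : Tree → ℕ → Set₁ where
  leaf : ∀ {k} {{_ : NonZero k}}
       → (label : Fin k → Label)
       → (exclusive : ∀ {u₁ u₂} → u₁ ≢ u₂ →
           ¬ (∃ λ v → T (evalLabel (label u₁) v) × T (evalLabel (label u₂) v)))
       → (complete : ∀ v → ∃ λ u → T (evalLabel (label u) v))
       → Diagram leaf k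
  node : ∀ {t₁ t₂ k k₁ k₂} {{_ : NonZero k}}
       → Diagram t₁ k₁
       → Diagram t₂ k₂
       → (E : Fin k → Pred (Fin k₁ × Fin k₂) 0ℓ)
       → IsPartition E
       → Diagram (node t₁ t₂) k

diagramWidth : ∀ {t k} → Diagram t k → ℕ
diagramWidth {k = k} (leaf _ _ _)     = k
diagramWidth {k = k} (node d₁ d₂ _ _) = k ⊔ (diagramWidth d₁ ⊔ diagramWidth d₂)

nodeFunction : ∀ {X t k} → (Leaf t → X) → Diagram t k → Fin k → BooleanFunction X
nodeFunction b (leaf label _ _)   u α = T (evalLabel (label u) (α (b here)))
nodeFunction b (node d₁ d₂ E _) u α = ∃₂ λ v w →
  E u (v , w) × nodeFunction (b ∘ left) d₁ v α × nodeFunction (b ∘ right) d₂ w α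

record TDD {X : Set} (V : VTree X) : Set₁ where
  open VTree V
  field
    {rootSize} : ℕ
    diagram    : Diagram tree rootSize
    Out        : Set
    λ-out      : Out ↔ Fin rootSize

  width : ℕ
  width = diagramWidth diagram

  function : Out → BooleanFunction X
  function ℓ = nodeFunction (Inverse.to b) diagram (Inverse.to λ-out ℓ)

-- Sinks carry pairwise distinct labels, so the sink labelled ℓ is taken to be
-- ℓ itself; the nodes are the m inner nodes together with the sinks.

module _ {Out : Set} {m : ℕ} (child : Fin m → Bool → Fin m ⊎ Out) where

  data Edge : Rel (Fin m ⊎ Out) 0ℓ where
    edge : ∀ i c → Edge (inj₁ i) (child i c)

  data Step {X : Set} (var : Fin m → X) (α : X → Bool) : Rel (Fin m ⊎ Out) 0ℓ where
    step : ∀ i → Step var α (inj₁ i) (child i (α (var i)))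

-- A sink may be unreachable, so "one source" can only refer to the inner
-- nodes: no edge enters the source, and every other inner node is entered by
-- some edge.

record MOBDD {X : Set} (_≼_ : Rel X 0ℓ) : Set₁ where
  open ToStrict _≡_ _≼_ using () renaming (_<_ to _≺_)
  field
    Out                  : Set
    innerCount sinkCount : ℕ
    Out-finite           : Out ↔ Fin sinkCount
    var                  : Fin innerCount → X
    child                : Fin innerCount → Bool → Fin innerCount ⊎ Out
    source               : Fin innerCount ⊎ Out
    acyclic              : ∀ {u} → ¬ TransClosure (Edge child) u u
    ordered              : ∀ {i j} → TransClosure (Edge child) (inj₁ i) (inj₁ j) →
                           var i ≺ var j
    source-initial       : ∀ {u} → ¬ Edge child u source
    source-unique        : ∀ {i} → (∀ {u} → ¬ Edge child u (inj₁ i)) → inj₁ i ≡ source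

  function : Out → BooleanFunction X
  function ℓ α = Star (Step child var α) source (inj₂ ℓ)

  size : ℕ
  size = innerCount + sinkCount

Corresponds : ∀ {X} {V : VTree X} {_≼_ : Rel X 0ℓ} → MOBDD _≼_ → TDD V → Set
Corresponds B D =
  Σ[ f ∈ (MOBDD.Out B ↔ TDD.Out D) ]
    ∀ ℓ → MOBDD.function B ℓ ≐ TDD.function D (Inverse.to f ℓ)

-- For n, w ≥ 1, RootLogBound C n w s says that
-- s ≤ C · (√n · w) ^ (log₂ n + 2)  over the reals.
-- Since √n · w ≥ 1, the right-hand side is the infimum of
-- C · (√n · w) ^ (p/q + 2)  over the rationals p/q ≥ log₂ n, that is, over
-- p and q > 0 with n ^ q ≤ 2 ^ p; raising  s ≤ C · (√n · w) ^ (p/q + 2)  to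
-- the power 2q removes the root and the denominator.

RootLogBound : (C n w s : ℕ) → Set
RootLogBound C n w s =
  ∀ p q → 0 < q → n ^ q ≤ 2 ^ p →
  s ^ (2 * q) ≤ C ^ (2 * q) * (n * w ^ 2) ^ (p + 2 * q)

-- Test the variables of the larger subtree first and hang a copy of the graph
-- of the smaller subtree below each of its reachable sinks.  With S(t) inner
-- nodes for a tree t this gives S(t) ≤ S(t₁) + w · S(t₂), where t₂ has at most
-- half of the leaves of t, hence S(t) ≤ n · w ^ ⌊log₂ n⌋.  Restricting to
-- reachable sinks keeps every inner node other than the source entered.

{-# OPTIONS --safe #-}
module Submission where

open import Defs
open import Data.Bool.Base using (Bool; true; false; T)
open import Data.Bool.Properties using (T-irrelevant)
open import Data.Empty using (⊥-elim)
open import Data.Fin.Base using (Fin; zero; suc)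
open import Data.Fin.Properties using (+↔⊎; *↔×; 1↔⊤; any?) renaming (_≟_ to _≟ᶠ_)
open import Data.Fin.Permutation using (↔⇒≡)
open import Data.Nat.Base using (ℕ; zero; suc; NonZero; _+_; _*_; _^_; _≤_; _<_; z≤n; s≤s; >-nonZero)
open import Data.Nat.Properties
open import Data.Nat.Tactic.RingSolver using (solve-∀)
open import Data.Product.Base using (Σ-syntax; ∃; ∃₂; _×_; _,_; proj₁; proj₂)
open import Data.Product.Function.NonDependent.Propositional using (_×-↔_)
open import Data.Sum.Base as Sum using (_⊎_; inj₁; inj₂; [_,_]′)
open import Data.Sum.Function.Propositional using (_⊎-↔_)
open import Data.Sum.Properties using (inj₂-injective; swap-↔)
open import Data.Unit.Base using (⊤; tt)
open import Function.Base using (_∘_)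
open import Function.Bundles using (_↔_; mk↔ₛ′; module Inverse; module Injection)
open import Function.Construct.Composition using (_↔-∘_)
open import Function.Construct.Identity using (↔-id)
open import Function.Construct.Symmetry using (↔-sym)
open import Function.Properties.Inverse using (↔⇒↣)
open import Level using (0ℓ)
open import Relation.Binary.Construct.Closure.ReflexiveTransitive using (Star; ε; _◅_)
open import Relation.Binary.Construct.Closure.Transitive using (TransClosure; [_]; _∷_)
open import Relation.Binary.Core using (Rel)
open import Relation.Binary.PropositionalEquality
  using (_≡_; refl; sym; trans; cong; subst; subst₂; isEquivalence)
open import Relation.Binary.Structures using (IsTotalOrder)
open import Relation.Nullary.Decidable using (Dec; yes; no; map′; ⌊_⌋; toWitness; fromWitness; _⊎-dec_)
open import Relation.Nullary.Negation using (contradiction)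

private
  variable
    A B K L L₁ L₂ N X : Set
    k k₁ k₂ : ℕ
    t t₁ t₂ : Tree

↔-injective : (e : A ↔ B) {x y : A} → Inverse.to e x ≡ Inverse.to e y → x ≡ y
↔-injective e = Injection.injective (↔⇒↣ e)

-- Finite types

ΣT-suc↔ : ∀ {n} (P : Fin (suc n) → Bool) →
          (∃ λ i → T (P i)) ↔ (T (P zero) ⊎ ∃ λ i → T (P (suc i)))
ΣT-suc↔ P = mk↔ₛ′
  (λ { (zero , p) → inj₁ p ; (suc i , p) → inj₂ (i , p) })
  (λ { (inj₁ p) → zero , p ; (inj₂ (i , p)) → suc i , p })
  (λ { (inj₁ p) → refl ; (inj₂ (i , p)) → refl })
  (λ { (zero , p) → refl ; (suc i , p) → refl })

T-finite : ∀ b → Σ[ m ∈ ℕ ] (m ≤ 1 × T b ↔ Fin m)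
T-finite false = 0 , z≤n , mk↔ₛ′ (λ ()) (λ ()) (λ ()) (λ ())
T-finite true  = 1 , ≤-refl , ↔-sym 1↔⊤

-- Proofs of `T b` are unique, so the pairs are counted exactly by the indices passing the test. The
-- exact count gives the bijection needed for a node count, and `m ≤ n` later bounds the number of
-- copies.
ΣT-finite : ∀ {n} (P : Fin n → Bool) → Σ[ m ∈ ℕ ] (m ≤ n × (∃ λ i → T (P i)) ↔ Fin m)
ΣT-finite {zero}  P = 0 , z≤n , mk↔ₛ′ (λ ()) (λ ()) (λ ()) (λ { (() , _) })
ΣT-finite {suc n} P =
  let m₁ , m₁≤1 , e₁ = T-finite (P zero)
      m₂ , m₂≤n , e₂ = ΣT-finite (P ∘ suc)
  in m₁ + m₂ , +-mono-≤ m₁≤1 m₂≤n , ↔-sym +↔⊎ ↔-∘ ((e₁ ⊎-↔ e₂) ↔-∘ ΣT-suc↔ P)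

-- Decision graphs

-- An inductive path instead of an evaluation function, so that no termination argument is needed.
-- The value of `child` enters through an equation, which lets a run be rebuilt in another graph by
-- `cong`.
data Run (var : N → L) (child : N → Bool → N ⊎ K) (α : L → Bool) : N → K → Set where
  stop : ∀ {i u} → child i (α (var i)) ≡ inj₂ u → Run var child α i u
  next : ∀ {i j u} → child i (α (var i)) ≡ inj₁ j →
         Run var child α j u → Run var child α i u

-- An invariant strong enough for the induction over the tree. The variable order is an injection
-- into the naturals; `child-rank` yields both acyclicity and ordering, and `source-rank` leaves no
-- room for an edge into the source. Sinks are numbered by `Fin k`, and the source is always an
-- inner node. `f` is the function computed by following runs.
record DecisionGraph (L : Set) (k : ℕ) (f : (L → Bool) → Fin k) : Set₁ where
  field
    rank           : L → ℕ
    rank-injective : ∀ {x y} → rank x ≡ rank y → x ≡ y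
    height         : ℕ
    rank<height    : ∀ x → rank x < height

    Node           : Set
    count          : ℕ
    finite         : Node ↔ Fin count
    var            : Node → L
    child          : Node → Bool → Node ⊎ Fin k
    source         : Node
    child-rank     : ∀ {i j} c → child i c ≡ inj₁ j → rank (var i) < rank (var j)
    source-rank    : rank (var source) ≡ 0
    entered        : ∀ i → i ≡ source ⊎ (∃₂ λ j c → child j c ≡ inj₁ i)
    run            : ∀ α → Run var child α source (f α)

  Entered : Fin k → Set
  Entered v = ∃₂ λ i c → child i c ≡ inj₂ v

  private
    sink? : ∀ v (x : Node ⊎ Fin k) → Dec (x ≡ inj₂ v)
    sink? v (inj₁ _) = no λ ()
    sink? v (inj₂ u) = map′ (cong inj₂) inj₂-injective (u ≟ᶠ v)

  entered? : ∀ v → Dec (Entered v)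
  entered? v = map′
    (λ { (m , inj₁ p) → from m , false , p ; (m , inj₂ p) → from m , true , p })
    (λ { (i , false , p) → to i , inj₁ (trans (cong (λ j → child j false) (strictlyInverseʳ i)) p)
       ; (i , true  , p) → to i , inj₂ (trans (cong (λ j → child j true) (strictlyInverseʳ i)) p) })
    (any? λ m → sink? v (child (from m) false) ⊎-dec sink? v (child (from m) true))
    where open Inverse finite

-- `G₁` is tested first. The bijection `split` and the combination `out` of the two results are
-- parameters so that either subtree can play the role of `G₁`.
module Glue
  {f₁ : (L₁ → Bool) → Fin k₁} {f₂ : (L₂ → Bool) → Fin k₂}
  (split : L ↔ (L₁ ⊎ L₂)) (out : Fin k₁ → Fin k₂ → Fin k)
  (G₁ : DecisionGraph L₁ k₁ f₁) (G₂ : DecisionGraph L₂ k₂ f₂)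
  where

  private
    module G₁ = DecisionGraph G₁
    module G₂ = DecisionGraph G₂
    module S  = Inverse split

  -- Entered is not a proposition; its truncation by T makes the copies of G₂
  -- unique.
  Exit : Set
  Exit = ∃ λ v → T ⌊ G₁.entered? v ⌋

  GNode : Set
  GNode = G₁.Node ⊎ (Exit × G₂.Node)

  exits : Σ[ m ∈ ℕ ] (m ≤ k₁ × Exit ↔ Fin m)
  exits = ΣT-finite λ v → ⌊ G₁.entered? v ⌋

  -- The shift by `G₁.height` places every variable of `G₂` after all those of `G₁`.
  rank⊎ : L₁ ⊎ L₂ → ℕ
  rank⊎ (inj₁ x) = G₁.rank x
  rank⊎ (inj₂ y) = G₁.height + G₂.rank y

  rank⊎-injective : ∀ x y → rank⊎ x ≡ rank⊎ y → x ≡ y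
  rank⊎-injective (inj₁ x) (inj₁ y) eq = cong inj₁ (G₁.rank-injective eq)
  rank⊎-injective (inj₁ x) (inj₂ y) eq =
    contradiction eq (<⇒≢ (<-≤-trans (G₁.rank<height x) (m≤m+n _ _)))
  rank⊎-injective (inj₂ x) (inj₁ y) eq =
    contradiction (sym eq) (<⇒≢ (<-≤-trans (G₁.rank<height y) (m≤m+n _ _)))
  rank⊎-injective (inj₂ x) (inj₂ y) eq =
    cong inj₂ (G₂.rank-injective (+-cancelˡ-≡ G₁.height _ _ eq))

  rank⊎<height : ∀ x → rank⊎ x < G₁.height + G₂.height
  rank⊎<height (inj₁ x) = <-≤-trans (G₁.rank<height x) (m≤m+n _ _)
  rank⊎<height (inj₂ y) = +-monoʳ-< G₁.height (G₂.rank<height y)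

  var⊎ : GNode → L₁ ⊎ L₂
  var⊎ (inj₁ i)       = inj₁ (G₁.var i)
  var⊎ (inj₂ (_ , j)) = inj₂ (G₂.var j)

  rank-var : ∀ i → rank⊎ (S.to (S.from (var⊎ i))) ≡ rank⊎ (var⊎ i)
  rank-var i = cong rank⊎ (S.strictlyInverseˡ (var⊎ i))

  -- The equation is passed along because entering a copy of `G₂` requires evidence that its exit is
  -- entered, and the edge being redirected is that evidence. Abstracting the target as `x` lets the
  -- lemmas below match on it while the equation stays opaque.
  attach : ∀ {i c} x → G₁.child i c ≡ x → GNode ⊎ Fin k
  attach         (inj₁ j) _  = inj₁ (inj₁ j)
  attach {i} {c} (inj₂ v) eq = inj₁ (inj₂ ((v , fromWitness (i , c , eq)) , G₂.source))

  gchild : GNode → Bool → GNode ⊎ Fin k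
  gchild (inj₁ i)       c = attach (G₁.child i c) refl
  gchild (inj₂ (x , j)) c = Sum.map (λ j′ → inj₂ (x , j′)) (out (proj₁ x)) (G₂.child j c)

  attach-inner : ∀ {i c j x} (eq : G₁.child i c ≡ x) → x ≡ inj₁ j → attach x eq ≡ inj₁ (inj₁ j)
  attach-inner eq refl = refl

  -- Different edges into the same sink carry different evidence, yet all lead to one copy, since
  -- `T` has unique proofs.
  attach-sink : ∀ {i c v x} (eq : G₁.child i c ≡ x) → x ≡ inj₂ v → (p : T ⌊ G₁.entered? v ⌋) →
                attach x eq ≡ inj₁ (inj₂ ((v , p) , G₂.source))
  attach-sink eq refl p = cong (λ q → inj₁ (inj₂ ((_ , q) , G₂.source))) (T-irrelevant _ p)

  attach-rank : ∀ {i c y} x (eq : G₁.child i c ≡ x) → attach x eq ≡ inj₁ y →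
                G₁.rank (G₁.var i) < rank⊎ (var⊎ y)
  attach-rank {c = c} (inj₁ j) eq refl = G₁.child-rank c eq
  attach-rank {i}     (inj₂ v) eq refl = <-≤-trans (G₁.rank<height (G₁.var i)) (m≤m+n _ _)

  gchild-rank : ∀ i {j} c → gchild i c ≡ inj₁ j → rank⊎ (var⊎ i) < rank⊎ (var⊎ j)
  gchild-rank (inj₁ i) c eq = attach-rank (G₁.child i c) refl eq
  gchild-rank (inj₂ (x , i)) c eq with G₂.child i c in eq₂
  gchild-rank (inj₂ (x , i)) c refl | inj₁ j = +-monoʳ-< G₁.height (G₂.child-rank c eq₂)

  gentered : ∀ i → i ≡ inj₁ G₁.source ⊎ (∃₂ λ j c → gchild j c ≡ inj₁ i)
  gentered (inj₁ i) with G₁.entered i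
  ... | inj₁ eq           = inj₁ (cong inj₁ eq)
  ... | inj₂ (j , c , eq) = inj₂ (inj₁ j , c , attach-inner refl eq)
  gentered (inj₂ ((v , p) , i)) with G₂.entered i
  ... | inj₂ (j , c , eq) = inj₂ (inj₂ ((v , p) , j) , c , cong (Sum.map _ _) eq)
  ... | inj₁ refl         =
    let j , c , eq = toWitness p
    in inj₂ (inj₁ j , c , attach-sink refl eq p)

  module _ (α : L → Bool) where

    private
      α₁ : L₁ → Bool
      α₁ = α ∘ S.from ∘ inj₁

      α₂ : L₂ → Bool
      α₂ = α ∘ S.from ∘ inj₂

      GRun : GNode → Fin k → Set
      GRun = Run (S.from ∘ var⊎) gchild α

    run₂ : ∀ {x i w} → Run G₂.var G₂.child α₂ i w → GRun (inj₂ (x , i)) (out (proj₁ x) w)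
    run₂ (stop eq)   = stop (cong (Sum.map _ _) eq)
    run₂ (next eq r) = next (cong (Sum.map _ _) eq) (run₂ r)

    run₁ : ∀ {i v w} → Run G₁.var G₁.child α₁ i v → Run G₂.var G₂.child α₂ G₂.source w →
           GRun (inj₁ i) (out v w)
    -- The last edge of the run in `G₁` itself shows that its sink is entered, so the copy of `G₂`
    -- exists.
    run₁ (stop eq)   r₂ = next (attach-sink refl eq (fromWitness (_ , _ , eq))) (run₂ r₂)
    run₁ (next eq r) r₂ = next (attach-inner refl eq) (run₁ r r₂)

  glue : DecisionGraph L k (λ α → out (f₁ (α ∘ S.from ∘ inj₁)) (f₂ (α ∘ S.from ∘ inj₂)))
  glue = record
    { rank           = rank⊎ ∘ S.to
    ; rank-injective = λ eq → ↔-injective split (rank⊎-injective _ _ eq)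
    ; height         = G₁.height + G₂.height
    ; rank<height    = rank⊎<height ∘ S.to
    ; Node           = GNode
    ; count          = G₁.count + proj₁ exits * G₂.count
    ; finite         = ↔-sym +↔⊎ ↔-∘
                       (G₁.finite ⊎-↔ (↔-sym *↔× ↔-∘ (proj₂ (proj₂ exits) ×-↔ G₂.finite)))
    ; var            = S.from ∘ var⊎
    ; child          = gchild
    ; source         = inj₁ G₁.source
    ; child-rank     = λ {i} {j} c eq →
        subst₂ _<_ (sym (rank-var i)) (sym (rank-var j)) (gchild-rank i c eq)
    ; source-rank    = trans (rank-var (inj₁ G₁.source)) G₁.source-rank
    ; entered        = gentered
    ; run            = λ α → run₁ α (G₁.run _) (G₂.run _)
    }

-- Diagrams

-- The node at the root satisfied by an assignment: completeness and covering give existence here,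
-- exclusiveness and disjointness give uniqueness below.
evalDiagram : Diagram t k → (Leaf t → Bool) → Fin k
evalDiagram (leaf _ _ complete) α = proj₁ (complete (α here))
evalDiagram (node d₁ d₂ _ part) α = proj₁
  (IsPartition.covers part (evalDiagram d₁ (α ∘ left) , evalDiagram d₂ (α ∘ right)))

evalDiagram-sound : (b : Leaf t → X) (d : Diagram t k) (α : X → Bool) →
                    nodeFunction b d (evalDiagram d (α ∘ b)) α
evalDiagram-sound b (leaf _ _ complete) α = proj₂ (complete (α (b here)))
evalDiagram-sound b (node d₁ d₂ _ part) α =
  _ , _ , proj₂ (IsPartition.covers part _) ,
  evalDiagram-sound (b ∘ left) d₁ α , evalDiagram-sound (b ∘ right) d₂ α

-- By induction the two child nodes are forced. Their pair then lies both in `E u` and in the part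
-- chosen by `covers`, so disjointness forces `u`.
evalDiagram-unique : (b : Leaf t → X) (d : Diagram t k) (α : X → Bool) (u : Fin k) →
                     nodeFunction b d u α → u ≡ evalDiagram d (α ∘ b)
evalDiagram-unique b d@(leaf label exclusive _) α u p with u ≟ᶠ evalDiagram d (α ∘ b)
... | yes eq = eq
... | no  ne = ⊥-elim (exclusive ne (α (b here) , p , evalDiagram-sound b d α))
evalDiagram-unique b d@(node d₁ d₂ E part) α u (v , w , e , p , q)
  with refl ← evalDiagram-unique (b ∘ left) d₁ α v p
     | refl ← evalDiagram-unique (b ∘ right) d₂ α w q
     | u ≟ᶠ evalDiagram d (α ∘ b)
... | yes eq = eq
... | no  ne = ⊥-elim (IsPartition.disjoint part ne _ (e , proj₂ (IsPartition.covers part _)))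

leaves : Tree → ℕ
leaves leaf         = 1
leaves (node t₁ t₂) = leaves t₁ + leaves t₂

leaves>0 : ∀ t → 0 < leaves t
leaves>0 leaf         = ≤-refl
leaves>0 (node t₁ t₂) = <-≤-trans (leaves>0 t₁) (m≤m+n _ _)

Leaf-node↔ : Leaf (node t₁ t₂) ↔ (Leaf t₁ ⊎ Leaf t₂)
Leaf-node↔ = mk↔ₛ′
  (λ { (left l) → inj₁ l ; (right l) → inj₂ l })
  [ left , right ]′
  (λ { (inj₁ l) → refl ; (inj₂ l) → refl })
  (λ { (left l) → refl ; (right l) → refl })

Leaf↔Fin : ∀ t → Leaf t ↔ Fin (leaves t)
Leaf↔Fin leaf = mk↔ₛ′ (λ _ → zero) (λ _ → here) (λ { zero → refl }) (λ { here → refl })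
Leaf↔Fin (node t₁ t₂) = ↔-sym +↔⊎ ↔-∘ ((Leaf↔Fin t₁ ⊎-↔ Leaf↔Fin t₂) ↔-∘ Leaf-node↔)

rootSize≤width : (d : Diagram t k) → k ≤ diagramWidth d
rootSize≤width (leaf _ _ _)   = ≤-refl
rootSize≤width (node _ _ _ _) = m≤m⊔n _ _

rootSize>0 : Diagram t k → 0 < k
rootSize>0 {k = suc _} _ = s≤s z≤n
rootSize>0 {k = zero} (leaf {{()}} _ _ _)
rootSize>0 {k = zero} (node {{()}} _ _ _ _)

-- The variable is tested even when `f` is constant, because the source has to be an inner node.
leafGraph : (f : Bool → Fin k) → DecisionGraph (Leaf leaf) k (λ α → f (α here))
leafGraph f = record
  { rank           = λ _ → 0
  ; rank-injective = λ { {here} {here} _ → refl }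
  ; height         = 1
  ; rank<height    = λ _ → s≤s z≤n
  ; Node           = ⊤
  ; count          = 1
  ; finite         = ↔-sym 1↔⊤
  ; var            = λ _ → here
  ; child          = λ _ c → inj₂ (f c)
  ; source         = tt
  ; child-rank     = λ _ ()
  ; source-rank    = refl
  ; entered        = λ _ → inj₁ refl
  ; run            = λ _ → stop refl
  }

-- Counting nodes

-- The smaller summand is at most half of the sum, which costs one factor of 2.
light<2^ : ∀ {m₁ m₂} l → m₂ ≤ m₁ → m₁ + m₂ < 2 ^ suc l → m₂ < 2 ^ l
light<2^ {m₁} {m₂} l m₂≤m₁ m<2^ = *-cancelˡ-< 2 _ _ (begin-strict
  2 * m₂    ≡⟨ cong (m₂ +_) (+-identityʳ m₂) ⟩
  m₂ + m₂   ≤⟨ +-monoˡ-≤ m₂ m₂≤m₁ ⟩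
  m₁ + m₂   <⟨ m<2^ ⟩
  2 ^ suc l ∎)
  where open ≤-Reasoning

module _ (W : ℕ) where

  -- Each copy of the lighter graph has one power of `W` to spare, and that power pays for the at
  -- most `W` copies.
  glue-count : ∀ {a b r} m₁ m₂ l → r ≤ W → a ≤ m₁ * W ^ suc l → b ≤ m₂ * W ^ l →
               a + r * b ≤ (m₁ + m₂) * W ^ suc l
  glue-count {a} {b} {r} m₁ m₂ l r≤W a≤ b≤ = begin
    a + r * b                           ≤⟨ +-mono-≤ a≤ (*-mono-≤ r≤W b≤) ⟩
    m₁ * (W * W ^ l) + W * (m₂ * W ^ l) ≡⟨ rearrange m₁ m₂ W (W ^ l) ⟩
    (m₁ + m₂) * (W * W ^ l)             ∎
    where
    open ≤-Reasoning
    rearrange : ∀ m₁ m₂ w x → m₁ * (w * x) + w * (m₂ * x) ≡ (m₁ + m₂) * (w * x)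
    rearrange = solve-∀

  -- `l` is only an upper bound for the rounded-down logarithm of the number of leaves. Hence the
  -- heavier subtree can keep it, while the lighter one decreases it by one.
  diagramGraph : ∀ l (d : Diagram t k) → diagramWidth d ≤ W → leaves t < 2 ^ suc l →
                 Σ[ G ∈ DecisionGraph (Leaf t) k (evalDiagram d) ]
                   DecisionGraph.count G ≤ leaves t * W ^ l
  diagramGraph l d@(leaf _ _ complete) w≤W _ =
    leafGraph (proj₁ ∘ complete) ,
    subst (1 ≤_) (sym (*-identityˡ _)) (m^n>0 W {{W≢0}} l)
    where
    W≢0 : NonZero W
    W≢0 = >-nonZero (<-≤-trans (rootSize>0 d) w≤W)
  -- An inner vertex has at least two leaves below it, so `l` cannot be 0.
  diagramGraph {t = node t₁ t₂} zero _ _ m<2 =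
    contradiction m<2 (≤⇒≯ (+-mono-≤ (leaves>0 t₁) (leaves>0 t₂)))
  diagramGraph {t = node t₁ t₂} (suc l) (node {k = k} d₁ d₂ E part) w≤W m<2^
    with ≤-total (leaves t₂) (leaves t₁)
  ... | inj₁ t₂≤t₁ =
    let G₁ , c₁ = diagramGraph (suc l) d₁ w₁≤W (≤-<-trans (m≤m+n _ _) m<2^)
        G₂ , c₂ = diagramGraph l d₂ w₂≤W (light<2^ (suc l) t₂≤t₁ m<2^)
        open Glue Leaf-node↔ (λ v w → proj₁ (IsPartition.covers part (v , w))) G₁ G₂
    in glue ,
       glue-count (leaves t₁) (leaves t₂) l
         (≤-trans (proj₁ (proj₂ exits)) (≤-trans (rootSize≤width d₁) w₁≤W)) c₁ c₂
    where
    w₁₂≤W = ≤-trans (m≤n⊔m k _) w≤W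
    w₁≤W  = ≤-trans (m≤m⊔n _ (diagramWidth d₂)) w₁₂≤W
    w₂≤W  = ≤-trans (m≤n⊔m (diagramWidth d₁) _) w₁₂≤W
  ... | inj₂ t₁≤t₂ =
    let G₁ , c₁ = diagramGraph l d₁ w₁≤W
                    (light<2^ (suc l) t₁≤t₂ (subst (_< 2 ^ suc (suc l)) (+-comm (leaves t₁) _) m<2^))
        G₂ , c₂ = diagramGraph (suc l) d₂ w₂≤W (≤-<-trans (m≤n+m _ _) m<2^)
        -- Here the second subtree is tested first. Swapping the split and the arguments of `covers`
        -- leaves the computed function equal to `evalDiagram` of the original node.
        open Glue (swap-↔ ↔-∘ Leaf-node↔) (λ w v → proj₁ (IsPartition.covers part (v , w))) G₂ G₁
    in glue ,
       subst (λ m → DecisionGraph.count glue ≤ m * W ^ suc l) (+-comm (leaves t₂) (leaves t₁))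
         (glue-count (leaves t₂) (leaves t₁) l
           (≤-trans (proj₁ (proj₂ exits)) (≤-trans (rootSize≤width d₂) w₂≤W)) c₂ c₁)
    where
    w₁₂≤W = ≤-trans (m≤n⊔m k _) w≤W
    w₁≤W  = ≤-trans (m≤m⊔n _ (diagramWidth d₂)) w₁₂≤W
    w₂≤W  = ≤-trans (m≤n⊔m (diagramWidth d₁) _) w₁₂≤W

-- Logarithms and the bound with real exponent

binaryLog : ∀ n → 1 ≤ n → ∃ λ l → 2 ^ l ≤ n × n < 2 ^ suc l
binaryLog (suc zero)      _ = 0 , ≤-refl , ≤-refl
binaryLog (suc n@(suc _)) _ with binaryLog n (s≤s z≤n)
... | l , 2^l≤n , n<2^ with m≤n⇒m<n∨m≡n n<2^
...   | inj₁ 1+n<2^ = l , m≤n⇒m≤1+n 2^l≤n , 1+n<2^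
...   | inj₂ 1+n≡2^ = suc l , ≤-reflexive (sym 1+n≡2^) ,
                      subst (_< 2 ^ suc (suc l)) (sym 1+n≡2^) (^-monoʳ-< 2 ≤-refl (n<1+n (suc l)))

2^-cancel-≤ : ∀ {a b} → 2 ^ a ≤ 2 ^ b → a ≤ b
2^-cancel-≤ {a} {b} 2^a≤2^b with a ≤? b
... | yes a≤b = a≤b
... | no  a≰b = contradiction 2^a≤2^b (<⇒≱ (^-monoʳ-< 2 ≤-refl (≰⇒> a≰b)))

^-distribʳ-* : ∀ m n o → (m * n) ^ o ≡ m ^ o * n ^ o
^-distribʳ-* m n zero    = refl
^-distribʳ-* m n (suc o) = trans (cong ((m * n) *_) (^-distribʳ-* m n o)) (rearrange m n (m ^ o) (n ^ o))
  where
  rearrange : ∀ m n x y → m * n * (x * y) ≡ m * x * (n * y)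
  rearrange = solve-∀

-- Inner nodes and sinks each contribute at most `n * w ^ (l + 2)`, whence the constant 2. From
-- `2 ^ l ≤ n` and `n ^ q ≤ 2 ^ p` follows `l * q ≤ p`, that is, `l` is at most p/q, which settles
-- the power of `w`. The factor `n` is the square of its root, and the exponent p/q + 2 is at least
-- 2.
size-RootLogBound : ∀ {n w c k} l → 1 ≤ n → 1 ≤ w → 2 ^ l ≤ n → c ≤ n * w ^ l → k ≤ w →
                    RootLogBound 2 n w (c + k)
size-RootLogBound {n} {w} {c} {k} l 1≤n 1≤w 2^l≤n c≤ k≤w p q 0<q n^q≤2^p = begin
  (c + k) ^ (2 * q)                             ≤⟨ ^-monoˡ-≤ (2 * q) c+k≤ ⟩
  (2 * (n * w ^ (l + 2))) ^ (2 * q)             ≡⟨ ^-distribʳ-* 2 _ (2 * q) ⟩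
  2 ^ (2 * q) * (n * w ^ (l + 2)) ^ (2 * q)     ≤⟨ *-monoʳ-≤ (2 ^ (2 * q)) power≤ ⟩
  2 ^ (2 * q) * (n * w ^ 2) ^ (p + 2 * q)       ∎
  where
  open ≤-Reasoning
  instance
    n≢0 : NonZero n
    n≢0 = >-nonZero 1≤n
    w≢0 : NonZero w
    w≢0 = >-nonZero 1≤w

  l*q≤p : l * q ≤ p
  l*q≤p = 2^-cancel-≤ (begin
    2 ^ (l * q) ≡⟨ ^-*-assoc 2 l q ⟨
    (2 ^ l) ^ q ≤⟨ ^-monoˡ-≤ q 2^l≤n ⟩
    n ^ q       ≤⟨ n^q≤2^p ⟩
    2 ^ p       ∎)

  c+k≤ : c + k ≤ 2 * (n * w ^ (l + 2))
  c+k≤ = begin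
    c + k                             ≤⟨ +-mono-≤ c≤ k≤w ⟩
    n * w ^ l + w                     ≤⟨ +-mono-≤ (*-monoʳ-≤ n (^-monoʳ-≤ w (m≤m+n l 2))) w≤ ⟩
    n * w ^ (l + 2) + n * w ^ (l + 2) ≡⟨ cong (n * w ^ (l + 2) +_) (+-identityʳ _) ⟨
    2 * (n * w ^ (l + 2))             ∎
    where
    w≤ : w ≤ n * w ^ (l + 2)
    w≤ = begin
      w               ≡⟨ ^-identityʳ w ⟨
      w ^ 1           ≤⟨ ^-monoʳ-≤ w (≤-trans (s≤s z≤n) (m≤n+m 2 l)) ⟩
      w ^ (l + 2)     ≤⟨ m≤n*m (w ^ (l + 2)) n ⟩
      n * w ^ (l + 2) ∎

  exponent : ∀ l q → (l + 2) * (2 * q) ≡ 2 * (l * q + 2 * q)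
  exponent = solve-∀

  power≤ : (n * w ^ (l + 2)) ^ (2 * q) ≤ (n * w ^ 2) ^ (p + 2 * q)
  power≤ = begin
    (n * w ^ (l + 2)) ^ (2 * q)                     ≡⟨ ^-distribʳ-* n _ (2 * q) ⟩
    n ^ (2 * q) * (w ^ (l + 2)) ^ (2 * q)           ≡⟨ cong (n ^ (2 * q) *_) (^-*-assoc w (l + 2) (2 * q)) ⟩
    n ^ (2 * q) * w ^ ((l + 2) * (2 * q))           ≡⟨ cong (λ e → n ^ (2 * q) * w ^ e) (exponent l q) ⟩
    n ^ (2 * q) * w ^ (2 * (l * q + 2 * q))         ≤⟨ *-mono-≤ (^-monoʳ-≤ n (m≤n+m (2 * q) p))
                                                        (^-monoʳ-≤ w (*-monoʳ-≤ 2 (+-monoˡ-≤ (2 * q) l*q≤p))) ⟩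
    n ^ (p + 2 * q) * w ^ (2 * (p + 2 * q))         ≡⟨ cong (n ^ (p + 2 * q) *_) (^-*-assoc w 2 (p + 2 * q)) ⟨
    n ^ (p + 2 * q) * (w ^ 2) ^ (p + 2 * q)         ≡⟨ ^-distribʳ-* n (w ^ 2) (p + 2 * q) ⟨
    (n * w ^ 2) ^ (p + 2 * q)                       ∎

-- Multisink OBDDs

-- Under a fixed assignment every inner node has exactly one step and a sink has none.
Star-sink-unique : ∀ {Out : Set} {m} {child : Fin m → Bool → Fin m ⊎ Out} {var : Fin m → X}
                   {α : X → Bool} {x ℓ ℓ′} →
                   Star (Step child var α) x (inj₂ ℓ) → Star (Step child var α) x (inj₂ ℓ′) → ℓ ≡ ℓ′
Star-sink-unique ε              ε               = refl
Star-sink-unique (step i ◅ s) (step .i ◅ s′) = Star-sink-unique s s′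

module ToMOBDD {f : (L → Bool) → Fin k} (G : DecisionGraph L k f)
               (b : L ↔ X) {Out : Set} (λ-out : Out ↔ Fin k) where

  private
    module G = DecisionGraph G
    module b = Inverse b
    module F = Inverse G.finite
    module O = Inverse λ-out

  rankX : X → ℕ
  rankX = G.rank ∘ b.from

  _≼_ : Rel X 0ℓ
  x ≼ y = rankX x ≤ rankX y

  ≼-isTotalOrder : IsTotalOrder _≡_ _≼_
  ≼-isTotalOrder = record
    { isPartialOrder = record
      { isPreorder = record
        { isEquivalence = isEquivalence
        ; reflexive     = λ { refl → ≤-refl }
        ; trans         = ≤-trans
        }
      ; antisym = λ p q → ↔-injective (↔-sym b) (G.rank-injective (≤-antisym p q))
      }
    ; total = λ x y → ≤-total (rankX x) (rankX y)
    }

  var : Fin G.count → X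
  var = b.to ∘ G.var ∘ F.from

  export : G.Node ⊎ Fin k → Fin G.count ⊎ Out
  export = Sum.map F.to O.from

  child : Fin G.count → Bool → Fin G.count ⊎ Out
  child i c = export (G.child (F.from i) c)

  -- A potential that strictly increases along every edge, sinks lying above all ranks. Acyclicity,
  -- orderedness and the absence of edges into the source are all read off from it.
  depth : Fin G.count ⊎ Out → ℕ
  depth (inj₁ i) = G.rank (G.var (F.from i))
  depth (inj₂ _) = G.height

  edge-depth : ∀ {x y} → Edge child x y → depth x < depth y
  edge-depth (edge i c) with G.child (F.from i) c in eq
  ... | inj₁ j = subst (λ j′ → depth (inj₁ i) < G.rank (G.var j′)) (sym (F.strictlyInverseʳ j))
                   (G.child-rank c eq)
  ... | inj₂ u = G.rank<height _

  path-depth : ∀ {x y} → TransClosure (Edge child) x y → depth x < depth y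
  path-depth [ e ]   = edge-depth e
  path-depth (e ∷ p) = <-trans (edge-depth e) (path-depth p)

  rankX-var : ∀ i → rankX (var i) ≡ depth (inj₁ i)
  rankX-var i = cong G.rank (b.strictlyInverseʳ _)

  var-ordered : ∀ {i j} → TransClosure (Edge child) (inj₁ i) (inj₁ j) → rankX (var i) < rankX (var j)
  var-ordered {i} {j} p = subst₂ _<_ (sym (rankX-var i)) (sym (rankX-var j)) (path-depth p)

  source-depth : depth (inj₁ (F.to G.source)) ≡ 0
  source-depth = trans (cong (G.rank ∘ G.var) (F.strictlyInverseʳ G.source)) G.source-rank

  child-export : ∀ {i c x} → G.child i c ≡ x → child (F.to i) c ≡ export x
  child-export {i} {c} eq = cong export (trans (cong (λ j → G.child j c) (F.strictlyInverseʳ i)) eq)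

  source-or-entered : ∀ i → i ≡ F.to G.source ⊎ (∃ λ x → Edge child x (inj₁ i))
  source-or-entered i with G.entered (F.from i)
  ... | inj₁ eq           = inj₁ (trans (sym (F.strictlyInverseˡ i)) (cong F.to eq))
  ... | inj₂ (j , c , eq) = inj₂ (inj₁ (F.to j) , subst (Edge child (inj₁ (F.to j)))
          (trans (child-export eq) (cong inj₁ (F.strictlyInverseˡ i))) (edge (F.to j) c))

  mobdd : MOBDD _≼_
  mobdd = record
    { Out            = Out
    ; innerCount     = G.count
    ; sinkCount      = k
    ; Out-finite     = λ-out
    ; var            = var
    ; child          = child
    ; source         = inj₁ (F.to G.source)
    ; acyclic        = λ p → <-irrefl refl (path-depth p)
    ; ordered        = λ p → <⇒≤ (var-ordered p) , λ eq → <-irrefl (cong rankX eq) (var-ordered p)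
    -- An edge into the source would start at a depth below 0.
    ; source-initial = λ {u} e → n≮0 (subst (depth u <_) source-depth (edge-depth e))
    ; source-unique  = λ {i} unentered → [ cong inj₁ , (λ (_ , e) → ⊥-elim (unentered e)) ]′ (source-or-entered i)
    }

  module _ (α : X → Bool) where

    run-step : ∀ {i x} → G.child i (α (b.to (G.var i))) ≡ x →
               Step child var α (inj₁ (F.to i)) (export x)
    run-step {i} eq = subst (Step child var α _)
      (trans (cong (λ j → child (F.to i) (α (b.to (G.var j)))) (F.strictlyInverseʳ i)) (child-export eq))
      (step (F.to i))

    run-star : ∀ {i u} → Run G.var G.child (α ∘ b.to) i u →
               Star (Step child var α) (inj₁ (F.to i)) (inj₂ (O.from u))
    run-star (stop eq)   = run-step eq ◅ ε
    run-star (next eq r) = run-step eq ◅ run-star r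

    function-value : MOBDD.function mobdd (O.from (f (α ∘ b.to))) α
    function-value = run-star (G.run (α ∘ b.to))

    -- The run of `G` reaches the sink of the computed value, and no other sink is reachable under
    -- the same assignment.
    function-sound : ∀ {ℓ} → MOBDD.function mobdd ℓ α → O.to ℓ ≡ f (α ∘ b.to)
    function-sound s = trans (cong O.to (Star-sink-unique s function-value)) (O.strictlyInverseˡ _)

    function-complete : ∀ {ℓ} → O.to ℓ ≡ f (α ∘ b.to) → MOBDD.function mobdd ℓ α
    function-complete {ℓ} eq = subst (λ ℓ′ → MOBDD.function mobdd ℓ′ α)
      (trans (cong O.from (sym eq)) (O.strictlyInverseʳ ℓ)) function-value

theorem9 : Σ[ C ∈ ℕ ] (0 < C ×
    ((X : Set) (n : ℕ) → X ↔ Fin n → 1 ≤ n →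
    (V : VTree X) (D : TDD V) →
    Σ[ _≼_ ∈ Rel X 0ℓ ] (IsTotalOrder _≡_ _≼_ ×
    (Σ[ B ∈ MOBDD _≼_ ] (Corresponds B D ×
    RootLogBound C n (TDD.width D) (MOBDD.size B))))))
theorem9 = 2 , s≤s z≤n , λ X n X↔n 1≤n V D →
  let open VTree V
      open TDD D using (diagram; width; λ-out)
      module b = Inverse b
      -- Leaves, variables and `Fin n` are in bijection, which turns the leaf count of the
      -- construction into `n`.
      leaves≡n = ↔⇒≡ (X↔n ↔-∘ (b ↔-∘ ↔-sym (Leaf↔Fin tree)))
      l , 2^l≤n , n<2^ = binaryLog n 1≤n
      G , count≤ = diagramGraph width l diagram ≤-refl (subst (_< 2 ^ suc l) (sym leaves≡n) n<2^)
      open ToMOBDD G b λ-out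
  in _≼_ , ≼-isTotalOrder , mobdd ,
     -- The sinks carry the output labels of `D` themselves, so the identity is the required
     -- bijection.
     (↔-id _ , λ ℓ →
       (λ {α} s → subst (λ u → nodeFunction b.to diagram u α) (sym (function-sound α s))
                    (evalDiagram-sound b.to diagram α)) ,
       (λ {α} p → function-complete α (evalDiagram-unique b.to diagram α _ p))) ,
     size-RootLogBound l 1≤n (≤-trans (rootSize>0 diagram) (rootSize≤width diagram)) 2^l≤n
       (subst (λ m → DecisionGraph.count G ≤ m * width ^ l) leaves≡n count≤)
       (rootSize≤width diagram)
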